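{- Let $n\ge 1$ and $0\le k\le n$ be integers. Let $\mathcal{B}(n,k)$ be the set of all barrier tilings of a $1\times n$ strip with barrier point $k$, and let $B(T)$ be the weight of a barrier tiling $T$. Then $$[F_{n+1}]_q=\sum_{T\in\mathcal{B}(n,k)}B(T).$$
   Context: Fibonacci numbers: $F_0=0$, $F_1=1$, $F_n=F_{n-1}+F_{n-2}$. For an integer $m\ge 0$, $[m]_q=\sum_{i=0}^{m-1}q^i$ (so $[0]_q=0$), with $q$ an indeterminate. Barrier tilings. Consider a $1\times n$ strip with cells numbered $1,\dots,n$ from left to right. The barrier point $k$ is the point on the bottom of the strip located after exactly $k$ cells from the left end. A barrier is of one of two types. An $I$ barrier moves one unit vertically up from the barrier point, so it splits the strip into a left compartment consisting of cells $1,\dots,k$ and a right compartment consisting of cells $k+1,\dots,n$. An $L$ barrier moves first one unit to the left and then one unit vertically up, so it splits the strip into a left compartment consisting of cells $1,\dots,k-1$ and a right compartment consisting of cells $k,\dots,n$ (it requires $k\ge 1$). A barrier tiling with barrier point $k$ consists of a choice of barrier ($I$ or $L$) together with a tiling of each of the two compartments, independently, by monominos (covering one cell) and dominos (covering two adjacent cells of the same compartment), subject to the constraint that, if the barrier is of type $L$, the first (leftmost) tile of the right compartment must be a domino, i.e. a domino covering cells $k$ and $k+1$; this domino is called the special domino. In particular an $L$ barrier can occur only when $1\le k\le n-1$. Compartments may be empty, in which case they have exactly one (empty) tiling. Weights. The height of an $I$ barrier is one plus the number of cells in the right compartment, that is, $n-k+1$. The height of an $L$ barrier is one plus the number of cells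 in the left compartment, that is, $k$. The height $h(d)$ of a domino $d$ is the height of the barrier of the tiling. The floor $f(d)$ of a domino $d$ is the number of cells between the end of the strip lying in the same compartment as $d$ and the farthest end of $d$ from that end of the strip: if $d$ covers cells $i-1,i$ and lies in the left compartment, then $f(d)=i$; if $d$ covers cells $i,i+1$ and lies in the right compartment, then $f(d)=n-i+1$. Each monomino has weight $1$. A domino $d$ in the right compartment of an $I$ barrier or in the left compartment of an $L$ barrier has weight $q^{F_{f(d)}}$. A domino $d$ in the left compartment of an $I$ barrier, or a non-special domino $d$ in the right compartment of an $L$ barrier, has weight $q^{F_{f(d)}F_{h(d)}}$. The special domino $d$ has weight $q^{F_{f(d)}F_{h(d)+1}}$. The weight $B(T)$ of a barrier tiling $T$ is the product of the weights of all its tiles. -}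

module Defs where

open import Algebra.Bundles.Raw using (RawSemiring)
import Algebra.Definitions.RawSemiring as RawSemiringDefinitions
open import Data.Empty using (⊥)
open import Data.Integer.Base as ℤ using (ℤ; 0ℤ; 1ℤ)
open import Data.List.Base
  using (List; []; _∷_; [_]; _++_; map; foldr; upTo; cartesianProductWith)
open import Data.List.Membership.Propositional using (_∈_)
open import Data.List.Membership.Propositional.Properties
  using (∈-map⁺; ∈-map⁻; ∈-++⁺ˡ; ∈-++⁺ʳ; ∈-cartesianProductWith⁺; ∈-cartesianProductWith⁻)
open import Data.List.Relation.Unary.All using ([])
open import Data.List.Relation.Unary.AllPairs using ([]; _∷_)
open import Data.List.Relation.Unary.Any using (here)
open import Data.List.Relation.Unary.Unique.Propositional using (Unique)
import Data.List.Relation.Unary.Unique.Propositional.Properties as Unique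
open import Data.Nat.Base using (ℕ; zero; suc; _+_; _*_; _∸_; _≤_; z≤n; s≤s)
open import Data.Product.Base using (∃; _,_; _×_)
open import Level using (0ℓ)
open import Relation.Binary.PropositionalEquality using (_≡_; refl)

F : ℕ → ℕ
F zero          = 0
F (suc zero)    = 1
F (suc (suc n)) = F (suc n) + F n

------------------------------------------------------------------------
-- The polynomial ring ℤ[q]

-- Coefficients in order of increasing degree. Trailing zeros are allowed, so
-- the equality of polynomials is _≈_ and not _≡_.
Poly : Set
Poly = List ℤ

coeff : Poly → ℕ → ℤ
coeff []      _       = 0ℤ
coeff (a ∷ p) zero    = a
coeff (a ∷ p) (suc i) = coeff p i

infix  4 _≈_
infixl 6 _+ᴾ_
infixl 7 _*ᴾ_

_≈_ : Poly → Poly → Set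
p ≈ r = ∀ i → coeff p i ≡ coeff r i

0ᴾ 1ᴾ q : Poly
0ᴾ = []
1ᴾ = 1ℤ ∷ []
q  = 0ℤ ∷ 1ℤ ∷ []

_+ᴾ_ : Poly → Poly → Poly
[]      +ᴾ r       = r
(a ∷ p) +ᴾ []      = a ∷ p
(a ∷ p) +ᴾ (b ∷ r) = (a ℤ.+ b) ∷ (p +ᴾ r)

_*ᴾ_ : Poly → Poly → Poly
[]      *ᴾ r = []
(a ∷ p) *ᴾ r = map (a ℤ.*_) r +ᴾ (0ℤ ∷ (p *ᴾ r))

ℤ[q] : RawSemiring 0ℓ 0ℓ
ℤ[q] = record
  { Carrier = Poly
  ; _≈_     = _≈_
  ; _+_     = _+ᴾ_
  ; _*_     = _*ᴾ_
  ; 0#      = 0ᴾ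
  ; 1#      = 1ᴾ
  }

open RawSemiringDefinitions ℤ[q] public using (_^_)

sumᴾ : List Poly → Poly
sumᴾ = foldr _+ᴾ_ 0ᴾ

[_]q : ℕ → Poly
[ m ]q = sumᴾ (map (q ^_) (upTo m))

------------------------------------------------------------------------
-- Sums over finite types

record Enumeration (A : Set) : Set where
  field
    elements : List A
    unique   : Unique elements
    complete : ∀ x → x ∈ elements

∑ : {A : Set} → Enumeration A → (A → Poly) → Poly
∑ E f = sumᴾ (map f (Enumeration.elements E))

------------------------------------------------------------------------
-- Barrier tilings

-- Tilings of a compartment of the given number of cells, tiles listed from
-- left to right.
data Tiling : ℕ → Set where
  empty    : Tiling 0
  monomino : ∀ {m} → Tiling m → Tiling (1 + m)
  domino   : ∀ {m} → Tiling m → Tiling (2 + m)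

data StartsWithDomino : ∀ {m} → Tiling m → Set where
  domino : ∀ {m} (t : Tiling m) → StartsWithDomino (domino t)

-- For k ≤ n, the right compartment of an L barrier, cells k,…,n, has
-- 1 + (n ∸ k) cells. The requirement k ≤ n − 1 for L is forced by
-- StartsWithDomino. The proof of 1 ≤ k is irrelevant so that it does not
-- contribute to counting tilings.
data BarrierTiling (n k : ℕ) : Set where
  I : Tiling k → Tiling (n ∸ k) → BarrierTiling n k
  L : .(1 ≤ k) → Tiling (k ∸ 1) →
      (right : Tiling (1 + (n ∸ k))) → StartsWithDomino right →
      BarrierTiling n k

height : ∀ {n k} → BarrierTiling n k → ℕ
height {n} {k} (I _ _)     = 1 + (n ∸ k)
height {n} {k} (L _ _ _ _) = k

-- Floors of the domino covering cells i and i + 1 of a strip of n cells.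
leftFloor : ℕ → ℕ
leftFloor i = 1 + i

rightFloor : ℕ → ℕ → ℕ
rightFloor n i = (1 + n) ∸ i

-- weightFrom w i t is the product of the weights of the tiles of t, where t
-- occupies a compartment whose first cell is i, and a domino covering cells
-- j and j + 1 has weight w j.
weightFrom : (ℕ → Poly) → ℕ → ∀ {m} → Tiling m → Poly
weightFrom w i empty        = 1ᴾ
weightFrom w i (monomino t) = 1ᴾ *ᴾ weightFrom w (1 + i) t
weightFrom w i (domino t)   = w i *ᴾ weightFrom w (2 + i) t

B : ∀ {n k} → BarrierTiling n k → Poly
B {n} {k} T@(I left right) =
     weightFrom (λ i → q ^ (F (leftFloor i) * F (height T))) 1 left
  *ᴾ weightFrom (λ i → q ^ F (rightFloor n i)) (1 + k) right
B {n} {k} T@(L _ left right starts) =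
     weightFrom (λ i → q ^ F (leftFloor i)) 1 left
  *ᴾ rightWeight starts
  where
  rightWeight : ∀ {m} {t : Tiling m} → StartsWithDomino t → Poly
  rightWeight (domino t) =
       q ^ (F (rightFloor n k) * F (height T + 1))
    *ᴾ weightFrom (λ i → q ^ (F (rightFloor n i) * F (height T))) (2 + k) t

------------------------------------------------------------------------
-- Enumeration of the barrier tilings

tilings : ∀ m → List (Tiling m)
tilings zero          = [ empty ]
tilings (suc zero)    = [ monomino empty ]
tilings (suc (suc m)) = map monomino (tilings (suc m)) ++ map domino (tilings m)

tilings-unique : ∀ m → Unique (tilings m)
tilings-unique zero          = [] ∷ []
tilings-unique (suc zero)    = [] ∷ []
tilings-unique (suc (suc m)) = Unique.++⁺
  (Unique.map⁺ (λ { refl → refl }) (tilings-unique (suc m)))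
  (Unique.map⁺ (λ { refl → refl }) (tilings-unique m))
  λ { (x∈ , y∈) → disjoint (∈-map⁻ monomino x∈) (∈-map⁻ domino y∈) }
  where
  disjoint : ∀ {t : Tiling (2 + m)} →
             ∃ (λ u → u ∈ tilings (suc m) × t ≡ monomino u) →
             ∃ (λ u → u ∈ tilings m × t ≡ domino u) → ⊥
  disjoint (_ , _ , refl) (_ , _ , ())

tilings-complete : ∀ {m} (t : Tiling m) → t ∈ tilings m
tilings-complete empty                       = here refl
tilings-complete (monomino {zero} empty)     = here refl
tilings-complete (monomino {suc m} t)        = ∈-++⁺ˡ (∈-map⁺ monomino (tilings-complete t))
tilings-complete (domino {m} t)              =
  ∈-++⁺ʳ (map monomino (tilings (suc m))) (∈-map⁺ domino (tilings-complete t))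

DominoFirst : ℕ → Set
DominoFirst m = ∃ λ (t : Tiling m) → StartsWithDomino t

dominoFirst : ∀ m → List (DominoFirst m)
dominoFirst zero          = []
dominoFirst (suc zero)    = []
dominoFirst (suc (suc m)) = map (λ t → domino t , domino t) (tilings m)

dominoFirst-unique : ∀ m → Unique (dominoFirst m)
dominoFirst-unique zero          = []
dominoFirst-unique (suc zero)    = []
dominoFirst-unique (suc (suc m)) =
  Unique.map⁺ (λ { refl → refl }) (tilings-unique m)

dominoFirst-complete : ∀ {m} {t : Tiling m} (s : StartsWithDomino t) → (t , s) ∈ dominoFirst m
dominoFirst-complete (domino t) = ∈-map⁺ (λ u → domino u , domino u) (tilings-complete t)

mkL : ∀ {n j} → Tiling j → DominoFirst (1 + (n ∸ suc j)) → BarrierTiling n (suc j)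
mkL l (r , s) = L (s≤s z≤n) l r s

tilingsI : ∀ n k → List (BarrierTiling n k)
tilingsI n k = cartesianProductWith I (tilings k) (tilings (n ∸ k))

tilingsL : ∀ n k → List (BarrierTiling n k)
tilingsL n zero    = []
tilingsL n (suc j) = cartesianProductWith mkL (tilings j) (dominoFirst (1 + (n ∸ suc j)))

barrierTilings : ∀ n k → Enumeration (BarrierTiling n k)
barrierTilings n k = record
  { elements = tilingsI n k ++ tilingsL n k
  ; unique   = Unique.++⁺ uniqueI (uniqueL k) (λ { (x∈ , y∈) → disjoint k x∈ y∈ })
  ; complete = complete k
  }
  where
  uniqueI : Unique (tilingsI n k)
  uniqueI = Unique.cartesianProductWith⁺ I (λ { refl → refl , refl })
    (tilings-unique k) (tilings-unique (n ∸ k))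

  uniqueL : ∀ k → Unique (tilingsL n k)
  uniqueL zero    = []
  uniqueL (suc j) = Unique.cartesianProductWith⁺ mkL (λ { refl → refl , refl })
    (tilings-unique j) (dominoFirst-unique (1 + (n ∸ suc j)))

  disjoint : ∀ k {T : BarrierTiling n k} → T ∈ tilingsI n k → T ∈ tilingsL n k → ⊥
  disjoint (suc j) x∈ y∈
    with ∈-cartesianProductWith⁻ I (tilings (suc j)) (tilings (n ∸ suc j)) x∈
       | ∈-cartesianProductWith⁻ mkL (tilings j) (dominoFirst (1 + (n ∸ suc j))) y∈
  ... | _ , _ , _ , _ , refl | _ , _ , _ , _ , ()

  complete : ∀ k (T : BarrierTiling n k) → T ∈ tilingsI n k ++ tilingsL n k
  complete k (I l r) =
    ∈-++⁺ˡ (∈-cartesianProductWith⁺ I (tilings-complete l) (tilings-complete r))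
  complete (suc j) (L _ l r s) = ∈-++⁺ʳ (tilingsI n (suc j))
    (∈-cartesianProductWith⁺ mkL (tilings-complete l) (dominoFirst-complete s))

module Submission where

-- Let S(m) be the weighted sum of the tilings of m cells in which a domino
-- with floor f has weight x ^ F f. Splitting on the tile farthest from the end
-- of the strip gives S(m) = S(m − 1) + x ^ F m · S(m − 2), so S(m) is the
-- geometric sum [F (m + 1)]ₓ. With x = q or x = q ^ F h the two compartments
-- contribute geometric sums whose product collapses by [a b]ₓ = [a]_{x ^ b} [b]ₓ:
-- the I barriers give [F (k + 1) F (n − k + 1)] and the L barriers
-- q ^ (F (k + 1) F (n − k + 1)) [F k F (n − k)]. These add up to [F (n + 1)]
-- by F (n + 1) = F (k + 1) F (n − k + 1) + F k F (n − k).

open import Defs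
  using ( F; Tiling; empty; monomino; domino; StartsWithDomino; BarrierTiling; I
        ; leftFloor; rightFloor; tilings; DominoFirst; dominoFirst; mkL; tilingsI; tilingsL )
open import Algebra.Bundles using (CommutativeSemiring)
open import Algebra.Structures.Biased using (isCommutativeMonoidˡ; isCommutativeSemiringˡ)
open import Data.Bool.Base using (Bool)
open import Data.Integer.Base as ℤ using (ℤ; 0ℤ; 1ℤ)
import Data.Integer.Properties as ℤ
import Data.Integer.Tactic.RingSolver as ℤ-Solver
open import Data.List.Base
  using (List; []; _∷_; _++_; map; foldr; upTo; applyUpTo; cartesianProductWith)
open import Data.List.Properties using (map-∘; map-++; map-upTo; map-applyUpTo)
open import Data.Maybe.Base using (Maybe; just; nothing)
open import Data.Nat.Base as ℕ using (ℕ; zero; suc; pred; _∸_; _≤_; z≤n; s≤s)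
import Data.Nat.Properties as ℕ
import Data.Nat.Tactic.RingSolver as ℕ-Solver
open import Data.Product.Base using (Σ; _,_; proj₂)
open import Function.Base using (_∘_)
open import Level using (0ℓ)
open import Relation.Binary.PropositionalEquality as ≡ using (_≡_; _≗_)
open import Relation.Binary.Structures using (IsEquivalence)
open import Tactic.Cong using (cong!)

-- Induction on `k` for all `m`, moving one unit from `k` to `m`. Combinatorially, a strip cut after
-- `k` cells either has a domino across the cut or not.
F-+ : ∀ k m → F (suc (k ℕ.+ m)) ≡ F (suc k) ℕ.* F (suc m) ℕ.+ F k ℕ.* F m
F-+ zero    m = ≡.sym (≡.trans (ℕ.+-identityʳ _) (ℕ.*-identityˡ (F (suc m))))
F-+ (suc k) m = begin
  F (suc (suc k ℕ.+ m))
    ≡⟨ ≡.cong (F ∘ suc) (ℕ.+-suc k m) ⟨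
  F (suc (k ℕ.+ suc m))
    ≡⟨ F-+ k (suc m) ⟩
  F (suc k) ℕ.* (F (suc m) ℕ.+ F m) ℕ.+ F k ℕ.* F (suc m)
    ≡⟨ algebra (F (suc k)) (F k) (F (suc m)) (F m) ⟩
  (F (suc k) ℕ.+ F k) ℕ.* F (suc m) ℕ.+ F (suc k) ℕ.* F m ∎
  where
  open ≡.≡-Reasoning
  algebra : ∀ a b c d → a ℕ.* (c ℕ.+ d) ℕ.+ b ℕ.* c ≡ (a ℕ.+ b) ℕ.* c ℕ.+ a ℕ.* d
  algebra = ℕ-Solver.solve-∀

module BarrierSums {c ℓ} (R : CommutativeSemiring c ℓ) where

  open CommutativeSemiring R
    renaming (_≈_ to infix 4 _≈_; _+_ to infixl 6 _+_; _*_ to infixl 7 _*_)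
  open import Algebra.Properties.Semiring.Exp semiring
    using (^-assocʳ) renaming (_^_ to infixr 8 _^_)
  open import Algebra.Properties.CommutativeSemigroup *-commutativeSemigroup using (x∙yz≈y∙xz)
  open import Algebra.Solver.Ring.NaturalCoefficients.Default R using (solve; _:=_; _:+_; _:*_)
  open import Relation.Binary.Reasoning.Setoid setoid

  -- Finite sums in a commutative semiring

  sum : List Carrier → Carrier
  sum = foldr _+_ 0#

  sum-++ : ∀ xs ys → sum (xs ++ ys) ≈ sum xs + sum ys
  sum-++ []       ys = sym (+-identityˡ (sum ys))
  sum-++ (x ∷ xs) ys = begin
    x + sum (xs ++ ys)       ≈⟨ +-congˡ (sum-++ xs ys) ⟩
    x + (sum xs + sum ys)    ≈⟨ +-assoc x (sum xs) (sum ys) ⟨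
    x + sum xs + sum ys      ∎

  sum-map-cong : ∀ {A : Set} {f g : A → Carrier} → (∀ x → f x ≈ g x) →
                 ∀ xs → sum (map f xs) ≈ sum (map g xs)
  sum-map-cong f≈g []       = refl
  sum-map-cong f≈g (x ∷ xs) = +-cong (f≈g x) (sum-map-cong f≈g xs)

  sum-map-*ˡ : ∀ {A : Set} a (f : A → Carrier) xs →
               sum (map (λ x → a * f x) xs) ≈ a * sum (map f xs)
  sum-map-*ˡ a f []       = sym (zeroʳ a)
  sum-map-*ˡ a f (x ∷ xs) = begin
    a * f x + sum (map (λ x → a * f x) xs)  ≈⟨ +-congˡ (sum-map-*ˡ a f xs) ⟩
    a * f x + a * sum (map f xs)            ≈⟨ distribˡ a (f x) (sum (map f xs)) ⟨
    a * (f x + sum (map f xs))              ∎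

  sum-map-map : ∀ {A B : Set} (f : B → Carrier) (g : A → B) xs →
                sum (map f (map g xs)) ≈ sum (map (f ∘ g) xs)
  sum-map-map f g xs = reflexive (≡.cong sum (≡.sym (map-∘ xs)))

  sum-map-++ : ∀ {A : Set} (f : A → Carrier) xs ys →
               sum (map f (xs ++ ys)) ≈ sum (map f xs) + sum (map f ys)
  sum-map-++ f xs ys =
    trans (reflexive (≡.cong sum (map-++ f xs ys))) (sum-++ (map f xs) (map f ys))

  sum-cartesianProductWith :
    ∀ {A B C : Set} (h : C → Carrier) (u : A → Carrier) (v : B → Carrier) {f : A → B → C} →
    (∀ x y → h (f x y) ≈ u x * v y) → ∀ xs ys →
    sum (map h (cartesianProductWith f xs ys)) ≈ sum (map u xs) * sum (map v ys)
  sum-cartesianProductWith h u v {f} h≈ []       ys = sym (zeroˡ (sum (map v ys)))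
  sum-cartesianProductWith h u v {f} h≈ (x ∷ xs) ys = begin
    sum (map h (map (f x) ys ++ cartesianProductWith f xs ys))
      ≈⟨ sum-map-++ h (map (f x) ys) _ ⟩
    sum (map h (map (f x) ys)) + sum (map h (cartesianProductWith f xs ys))
      ≈⟨ +-cong (sum-map-map h (f x) ys) (sum-cartesianProductWith h u v h≈ xs ys) ⟩
    sum (map (h ∘ f x) ys) + sum (map u xs) * sum (map v ys)
      ≈⟨ +-congʳ (sum-map-cong (h≈ x) ys) ⟩
    sum (map (λ y → u x * v y) ys) + sum (map u xs) * sum (map v ys)
      ≈⟨ +-congʳ (sum-map-*ˡ (u x) v ys) ⟩
    u x * sum (map v ys) + sum (map u xs) * sum (map v ys)
      ≈⟨ distribʳ (sum (map v ys)) (u x) (sum (map u xs)) ⟨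
    (u x + sum (map u xs)) * sum (map v ys) ∎

  -- Geometric sums

  geometric : Carrier → ℕ → Carrier
  geometric x m = sum (map (x ^_) (upTo m))

  geometric-suc : ∀ x m → geometric x (suc m) ≈ 1# + x * geometric x m
  geometric-suc x m = +-congˡ (begin
    sum (map (x ^_) (applyUpTo suc m))        ≈⟨ reflexive (≡.cong sum (map-applyUpTo suc (x ^_) m)) ⟩
    sum (applyUpTo (λ i → x * x ^ i) m)       ≈⟨ reflexive (≡.cong sum (map-upTo (λ i → x * x ^ i) m)) ⟨
    sum (map (λ i → x * x ^ i) (upTo m))      ≈⟨ sum-map-*ˡ x (x ^_) (upTo m) ⟩
    x * geometric x m                         ∎)

  geometric-+ : ∀ x a b → geometric x (a ℕ.+ b) ≈ geometric x a + x ^ a * geometric x b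
  geometric-+ x zero    b = sym (trans (+-identityˡ _) (*-identityˡ (geometric x b)))
  geometric-+ x (suc a) b = begin
    geometric x (suc (a ℕ.+ b))
      ≈⟨ geometric-suc x (a ℕ.+ b) ⟩
    1# + x * geometric x (a ℕ.+ b)
      ≈⟨ +-congˡ (*-congˡ (geometric-+ x a b)) ⟩
    1# + x * (geometric x a + x ^ a * geometric x b)
      ≈⟨ +-congˡ (distribˡ x _ _) ⟩
    1# + (x * geometric x a + x * (x ^ a * geometric x b))
      ≈⟨ +-assoc 1# _ _ ⟨
    1# + x * geometric x a + x * (x ^ a * geometric x b)
      ≈⟨ +-cong (geometric-suc x a) (*-assoc x (x ^ a) _) ⟨
    geometric x (suc a) + x ^ suc a * geometric x b ∎

  -- The exponents below `a * b` fall into `a` blocks of length `b`; the block starting at `j * b`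
  -- sums to `(x ^ b) ^ j` times `geometric x b`.
  geometric-* : ∀ x a b → geometric x (a ℕ.* b) ≈ geometric (x ^ b) a * geometric x b
  geometric-* x zero    b = sym (zeroˡ (geometric x b))
  geometric-* x (suc a) b = begin
    geometric x (b ℕ.+ a ℕ.* b)
      ≈⟨ geometric-+ x b (a ℕ.* b) ⟩
    geometric x b + x ^ b * geometric x (a ℕ.* b)
      ≈⟨ +-cong (sym (*-identityˡ _))
                (trans (*-congˡ (geometric-* x a b)) (sym (*-assoc _ _ _))) ⟩
    1# * geometric x b + x ^ b * geometric (x ^ b) a * geometric x b
      ≈⟨ distribʳ (geometric x b) 1# _ ⟨
    (1# + x ^ b * geometric (x ^ b) a) * geometric x b
      ≈⟨ *-congʳ (geometric-suc (x ^ b) a) ⟨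
    geometric (x ^ b) (suc a) * geometric x b ∎

  geometric-F : ∀ x m → geometric x (F (3 ℕ.+ m)) ≈
                geometric x (F (2 ℕ.+ m)) + x ^ F (2 ℕ.+ m) * geometric x (F (1 ℕ.+ m))
  geometric-F x m = geometric-+ x (F (2 ℕ.+ m)) (F (1 ℕ.+ m))

  -- Tilings of a single compartment

  -- The analogue of `weightFrom` over any semiring; `weightFrom≡weight` identifies the two on
  -- polynomials.
  weight : (ℕ → Carrier) → ℕ → ∀ {m} → Tiling m → Carrier
  weight w i empty        = 1#
  weight w i (monomino t) = 1# * weight w (1 ℕ.+ i) t
  weight w i (domino t)   = w i * weight w (2 ℕ.+ i) t

  tilingSum : (ℕ → Carrier) → ℕ → ℕ → Carrier
  tilingSum w i m = sum (map (weight w i) (tilings m))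

  tilingSum-0 : ∀ w i → tilingSum w i 0 ≈ 1#
  tilingSum-0 w i = +-identityʳ 1#

  tilingSum-1 : ∀ w i → tilingSum w i 1 ≈ 1#
  tilingSum-1 w i = trans (+-identityʳ (1# * 1#)) (*-identityˡ 1#)

  tilingSum-cons : ∀ w i m → tilingSum w i (2 ℕ.+ m) ≈
                   tilingSum w (1 ℕ.+ i) (1 ℕ.+ m) + w i * tilingSum w (2 ℕ.+ i) m
  tilingSum-cons w i m = begin
    sum (map (weight w i) (map monomino (tilings (1 ℕ.+ m)) ++ map domino (tilings m)))
      ≈⟨ sum-map-++ (weight w i) (map monomino (tilings (1 ℕ.+ m))) _ ⟩
    sum (map (weight w i) (map monomino (tilings (1 ℕ.+ m)))) +
    sum (map (weight w i) (map domino (tilings m)))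
      ≈⟨ +-cong (sum-map-map (weight w i) monomino (tilings (1 ℕ.+ m)))
                (sum-map-map (weight w i) domino (tilings m)) ⟩
    sum (map (λ t → 1# * weight w (1 ℕ.+ i) t) (tilings (1 ℕ.+ m))) +
    sum (map (λ t → w i * weight w (2 ℕ.+ i) t) (tilings m))
      ≈⟨ +-cong (trans (sum-map-*ˡ 1# (weight w (1 ℕ.+ i)) (tilings (1 ℕ.+ m))) (*-identityˡ _))
                (sum-map-*ˡ (w i) (weight w (2 ℕ.+ i)) (tilings m)) ⟩
    tilingSum w (1 ℕ.+ i) (1 ℕ.+ m) + w i * tilingSum w (2 ℕ.+ i) m ∎

  -- Floors in the left compartment grow from left to right, so they call for the
  -- recurrence at the right end, which holds as for any continuant.
  tilingSum-snoc : ∀ w i m → tilingSum w i (2 ℕ.+ m) ≈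
                   tilingSum w i (1 ℕ.+ m) + w (i ℕ.+ m) * tilingSum w i m
  tilingSum-snoc w i zero = begin
    tilingSum w i 2
      ≈⟨ tilingSum-cons w i 0 ⟩
    tilingSum w (1 ℕ.+ i) 1 + w i * tilingSum w (2 ℕ.+ i) 0
      ≈⟨ +-cong (tilingSum-1 w (1 ℕ.+ i))
                (*-cong (reflexive (≡.cong w (≡.sym (ℕ.+-identityʳ i)))) refl) ⟩
    1# + w (i ℕ.+ 0) * tilingSum w i 0
      ≈⟨ +-congʳ (tilingSum-1 w i) ⟨
    tilingSum w i 1 + w (i ℕ.+ 0) * tilingSum w i 0 ∎
  -- A second base case: a first domino leaves one cell, too few for the recurrence.
  tilingSum-snoc w i (suc zero) = begin
    tilingSum w i 3
      ≈⟨ tilingSum-cons w i 1 ⟩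
    tilingSum w (1 ℕ.+ i) 2 + w i * tilingSum w (2 ℕ.+ i) 1
      ≈⟨ +-cong (tilingSum-cons w (1 ℕ.+ i) 0) refl ⟩
    tilingSum w (2 ℕ.+ i) 1 + w (1 ℕ.+ i) * tilingSum w (3 ℕ.+ i) 0 +
    w i * tilingSum w (2 ℕ.+ i) 1
      ≈⟨ +-cong (+-cong refl (*-cong (reflexive (≡.cong w (ℕ.+-comm 1 i))) refl))
                (*-congˡ (trans (tilingSum-1 w (2 ℕ.+ i)) (sym (tilingSum-0 w i)))) ⟩
    tilingSum w (2 ℕ.+ i) 1 + w (i ℕ.+ 1) * tilingSum w i 0 + w i * tilingSum w i 0
      ≈⟨ solve 3 (λ a b c → a :+ b :+ c := a :+ c :+ b) refl _ _ _ ⟩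
    tilingSum w (2 ℕ.+ i) 1 + w i * tilingSum w i 0 + w (i ℕ.+ 1) * tilingSum w i 0
      ≈⟨ +-cong (sym (tilingSum-cons w i 0))
                (*-congˡ (trans (tilingSum-0 w i) (sym (tilingSum-1 w i)))) ⟩
    tilingSum w i 2 + w (i ℕ.+ 1) * tilingSum w i 1 ∎
  tilingSum-snoc w i (suc (suc m)) = begin
    tilingSum w i (4 ℕ.+ m)
      ≈⟨ tilingSum-cons w i (2 ℕ.+ m) ⟩
    tilingSum w (1 ℕ.+ i) (3 ℕ.+ m) + w i * tilingSum w (2 ℕ.+ i) (2 ℕ.+ m)
      ≈⟨ +-cong (tilingSum-snoc w (1 ℕ.+ i) (suc m))
                (*-congˡ (tilingSum-snoc w (2 ℕ.+ i) m)) ⟩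
    tilingSum w (1 ℕ.+ i) (2 ℕ.+ m) +
    w (1 ℕ.+ i ℕ.+ (1 ℕ.+ m)) * tilingSum w (1 ℕ.+ i) (1 ℕ.+ m) +
    w i * (tilingSum w (2 ℕ.+ i) (1 ℕ.+ m) + w (2 ℕ.+ i ℕ.+ m) * tilingSum w (2 ℕ.+ i) m)
      ≈⟨ +-cong (+-congˡ (*-congʳ (reflexive (≡.cong w eq₁))))
                (*-congˡ (+-congˡ (*-congʳ (reflexive (≡.cong w eq₂))))) ⟩
    tilingSum w (1 ℕ.+ i) (2 ℕ.+ m) +
    w (i ℕ.+ (2 ℕ.+ m)) * tilingSum w (1 ℕ.+ i) (1 ℕ.+ m) +
    w i * (tilingSum w (2 ℕ.+ i) (1 ℕ.+ m) + w (i ℕ.+ (2 ℕ.+ m)) * tilingSum w (2 ℕ.+ i) m)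
      -- The terms correspond to the choices of first and last tile; grouping by the last tile
      -- instead of the first swaps the two mixed ones.
      ≈⟨ solve 6 (λ a z b u c d → a :+ z :* b :+ u :* (c :+ z :* d) :=
                                  a :+ u :* c :+ z :* (b :+ u :* d)) refl _ _ _ _ _ _ ⟩
    tilingSum w (1 ℕ.+ i) (2 ℕ.+ m) + w i * tilingSum w (2 ℕ.+ i) (1 ℕ.+ m) +
    w (i ℕ.+ (2 ℕ.+ m)) * (tilingSum w (1 ℕ.+ i) (1 ℕ.+ m) + w i * tilingSum w (2 ℕ.+ i) m)
      ≈⟨ +-cong (tilingSum-cons w i (1 ℕ.+ m)) (*-congˡ (tilingSum-cons w i m)) ⟨
    tilingSum w i (3 ℕ.+ m) + w (i ℕ.+ (2 ℕ.+ m)) * tilingSum w i (2 ℕ.+ m) ∎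
    where
    eq₁ : 1 ℕ.+ i ℕ.+ (1 ℕ.+ m) ≡ i ℕ.+ (2 ℕ.+ m)
    eq₁ = ≡.sym (ℕ.+-suc i (1 ℕ.+ m))
    eq₂ : 2 ℕ.+ i ℕ.+ m ≡ i ℕ.+ (2 ℕ.+ m)
    eq₂ = ≡.trans (≡.cong suc (≡.sym (ℕ.+-suc i m))) eq₁

  tilingSum-cong : ∀ {w w′} → (∀ i → w i ≈ w′ i) → ∀ i m → tilingSum w i m ≈ tilingSum w′ i m
  tilingSum-cong {w} {w′} w≈w′ i m = sum-map-cong (go i) (tilings m)
    where
    go : ∀ i {m} (t : Tiling m) → weight w i t ≈ weight w′ i t
    go i empty        = refl
    go i (monomino t) = *-congˡ (go (1 ℕ.+ i) t)
    go i (domino t)   = *-cong (w≈w′ i) (go (2 ℕ.+ i) t)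

  -- A domino on the last two of `2 + m` cells has floor `2 + m`, so `tilingSum-snoc` becomes the
  -- recurrence `geometric-F`.
  leftSum : ∀ x m → tilingSum (λ i → x ^ F (leftFloor i)) 1 m ≈ geometric x (F (1 ℕ.+ m))
  leftSum x zero          = refl
  leftSum x (suc zero)    = +-congʳ (*-identityˡ 1#)
  leftSum x (suc (suc m)) = begin
    tilingSum w 1 (2 ℕ.+ m)
      ≈⟨ tilingSum-snoc w 1 m ⟩
    tilingSum w 1 (1 ℕ.+ m) + x ^ F (2 ℕ.+ m) * tilingSum w 1 m
      ≈⟨ +-cong (leftSum x (suc m)) (*-congˡ (leftSum x m)) ⟩
    geometric x (F (2 ℕ.+ m)) + x ^ F (2 ℕ.+ m) * geometric x (F (1 ℕ.+ m))
      ≈⟨ geometric-F x m ⟨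
    geometric x (F (3 ℕ.+ m)) ∎
    where
    w = λ i → x ^ F (leftFloor i)

  -- The equation says that the compartment reaches the right end of the strip, so a domino on the
  -- first two of `2 + m` cells has floor `2 + m`.
  rightSum : ∀ x n i m → i ℕ.+ m ≡ 1 ℕ.+ n →
             tilingSum (λ i → x ^ F (rightFloor n i)) i m ≈ geometric x (F (1 ℕ.+ m))
  rightSum x n i zero          _  = refl
  rightSum x n i (suc zero)    _  = +-congʳ (*-identityˡ 1#)
  rightSum x n i (suc (suc m)) i+m≡1+n = begin
    tilingSum w i (2 ℕ.+ m)
      ≈⟨ tilingSum-cons w i m ⟩
    tilingSum w (1 ℕ.+ i) (1 ℕ.+ m) + w i * tilingSum w (2 ℕ.+ i) m
      ≈⟨ +-cong (rightSum x n (1 ℕ.+ i) (suc m) 1+i+1+m≡1+n)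
                (*-cong (reflexive (≡.cong (λ f → x ^ F f) floor≡))
                        (rightSum x n (2 ℕ.+ i) m 2+i+m≡1+n)) ⟩
    geometric x (F (2 ℕ.+ m)) + x ^ F (2 ℕ.+ m) * geometric x (F (1 ℕ.+ m))
      ≈⟨ geometric-F x m ⟨
    geometric x (F (3 ℕ.+ m)) ∎
    where
    w = λ i → x ^ F (rightFloor n i)
    1+i+1+m≡1+n : 1 ℕ.+ i ℕ.+ (1 ℕ.+ m) ≡ 1 ℕ.+ n
    1+i+1+m≡1+n = ≡.trans (≡.sym (ℕ.+-suc i (1 ℕ.+ m))) i+m≡1+n
    2+i+m≡1+n : 2 ℕ.+ i ℕ.+ m ≡ 1 ℕ.+ n
    2+i+m≡1+n = ≡.trans (≡.cong suc (≡.sym (ℕ.+-suc i m))) 1+i+1+m≡1+n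
    floor≡ : rightFloor n i ≡ 2 ℕ.+ m
    floor≡ = ≡.trans (≡.cong (_∸ i) (≡.sym i+m≡1+n)) (ℕ.m+n∸m≡n i (2 ℕ.+ m))

  -- Moves the height into the base, so that `leftSum` and `rightSum` apply with base `x ^ h`.
  ^-assocˡ : ∀ x a b → x ^ (a ℕ.* b) ≈ (x ^ b) ^ a
  ^-assocˡ x a b = trans (reflexive (≡.cong (x ^_) (ℕ.*-comm a b))) (sym (^-assocʳ x b a))

  leftSum-* : ∀ x h m → tilingSum (λ i → x ^ (F (leftFloor i) ℕ.* h)) 1 m ≈
              geometric (x ^ h) (F (1 ℕ.+ m))
  leftSum-* x h m =
    trans (tilingSum-cong (λ i → ^-assocˡ x (F (leftFloor i)) h) 1 m) (leftSum (x ^ h) m)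

  rightSum-* : ∀ x h n i m → i ℕ.+ m ≡ 1 ℕ.+ n →
               tilingSum (λ i → x ^ (F (rightFloor n i) ℕ.* h)) i m ≈
               geometric (x ^ h) (F (1 ℕ.+ m))
  rightSum-* x h n i m eq =
    trans (tilingSum-cong (λ i → ^-assocˡ x (F (rightFloor n i)) h) i m)
          (rightSum (x ^ h) n i m eq)

  -- Sums over the I and the L barriers

  dominoWeight : Carrier → ℕ → ℕ → ∀ {m} {t : Tiling m} → StartsWithDomino t → Carrier
  dominoWeight x n k (domino t) =
    x ^ (F (rightFloor n k) ℕ.* F (k ℕ.+ 1)) *
    weight (λ i → x ^ (F (rightFloor n i) ℕ.* F k)) (2 ℕ.+ k) t

  dominoSum : ∀ x n k m → k ℕ.+ m ≡ n →
              sum (map (λ (_ , d) → dominoWeight x n k d) (dominoFirst (1 ℕ.+ m))) ≈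
              x ^ (F (1 ℕ.+ m) ℕ.* F (1 ℕ.+ k)) * geometric (x ^ F k) (F m)
  -- A single cell has no room for the special domino; on the other side `F 0 = 0` leaves an empty
  -- geometric sum.
  dominoSum x n k zero    _ = sym (zeroʳ _)
  dominoSum x n k (suc m) k+m≡n = begin
    sum (map (λ (_ , d) → dominoWeight x n k d) (map (λ t → domino t , domino t) (tilings m)))
      ≈⟨ sum-map-map _ _ (tilings m) ⟩
    sum (map (λ t → x ^ e * weight w (2 ℕ.+ k) t) (tilings m))
      ≈⟨ sum-map-*ˡ (x ^ e) (weight w (2 ℕ.+ k)) (tilings m) ⟩
    x ^ e * tilingSum w (2 ℕ.+ k) m
      ≈⟨ *-cong (reflexive (≡.cong (x ^_) e≡))
                (rightSum-* x (F k) n (2 ℕ.+ k) m 2+k+m≡1+n) ⟩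
    x ^ (F (2 ℕ.+ m) ℕ.* F (1 ℕ.+ k)) * geometric (x ^ F k) (F (1 ℕ.+ m)) ∎
    where
    e = F (rightFloor n k) ℕ.* F (k ℕ.+ 1)
    w = λ i → x ^ (F (rightFloor n i) ℕ.* F k)
    2+k+m≡1+n : 2 ℕ.+ k ℕ.+ m ≡ 1 ℕ.+ n
    2+k+m≡1+n = ≡.cong suc (≡.trans (≡.sym (ℕ.+-suc k m)) k+m≡n)
    1+n≡k+2+m : 1 ℕ.+ n ≡ k ℕ.+ (2 ℕ.+ m)
    1+n≡k+2+m = ≡.trans (≡.cong suc (≡.sym k+m≡n)) (≡.sym (ℕ.+-suc k (1 ℕ.+ m)))
    floor≡ : rightFloor n k ≡ 2 ℕ.+ m
    floor≡ = ≡.trans (≡.cong (_∸ k) 1+n≡k+2+m) (ℕ.m+n∸m≡n k (2 ℕ.+ m))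
    e≡ : e ≡ F (2 ℕ.+ m) ℕ.* F (1 ℕ.+ k)
    e≡ = ≡.cong₂ (λ f k′ → F f ℕ.* F k′) floor≡ (ℕ.+-comm k 1)

  module _ (x : Carrier) {n : ℕ} where

    sum-tilingsI :
      ∀ k → k ≤ n → (h : BarrierTiling n k → Carrier) →
      (∀ l r → h (I l r) ≈
        weight (λ i → x ^ (F (leftFloor i) ℕ.* F (1 ℕ.+ (n ∸ k)))) 1 l *
        weight (λ i → x ^ F (rightFloor n i)) (1 ℕ.+ k) r) →
      sum (map h (tilingsI n k)) ≈ geometric x (F (1 ℕ.+ k) ℕ.* F (1 ℕ.+ (n ∸ k)))
    sum-tilingsI k k≤n h h≈ = begin
      sum (map h (tilingsI n k))
        ≈⟨ sum-cartesianProductWith h (weight _ 1) (weight _ (1 ℕ.+ k)) h≈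
             (tilings k) (tilings (n ∸ k)) ⟩
      tilingSum (λ i → x ^ (F (leftFloor i) ℕ.* F (1 ℕ.+ (n ∸ k)))) 1 k *
      tilingSum (λ i → x ^ F (rightFloor n i)) (1 ℕ.+ k) (n ∸ k)
        ≈⟨ *-cong (leftSum-* x _ k)
                  (rightSum x n (1 ℕ.+ k) (n ∸ k) (≡.cong suc (ℕ.m+[n∸m]≡n k≤n))) ⟩
      geometric (x ^ F (1 ℕ.+ (n ∸ k))) (F (1 ℕ.+ k)) * geometric x (F (1 ℕ.+ (n ∸ k)))
        ≈⟨ geometric-* x (F (1 ℕ.+ k)) (F (1 ℕ.+ (n ∸ k))) ⟨
      geometric x (F (1 ℕ.+ k) ℕ.* F (1 ℕ.+ (n ∸ k))) ∎

    -- `h` is given at every barrier point so that its values on `mkL`, whose barrier point is a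
    -- successor, can be described before `k` is split.
    sum-tilingsL :
      ∀ k → k ≤ n → (h : ∀ {k} → BarrierTiling n k → Carrier) →
      (∀ {j} l (d : DominoFirst (1 ℕ.+ (n ∸ suc j))) → h (mkL l d) ≈
        weight (λ i → x ^ F (leftFloor i)) 1 l * dominoWeight x n (suc j) (proj₂ d)) →
      sum (map h (tilingsL n k)) ≈
      x ^ (F (1 ℕ.+ k) ℕ.* F (1 ℕ.+ (n ∸ k))) * geometric x (F k ℕ.* F (n ∸ k))
    sum-tilingsL zero    k≤n h h≈ = sym (zeroʳ _)
    sum-tilingsL k@(suc j) k≤n h h≈ = begin
      sum (map h (tilingsL n k))
        ≈⟨ sum-cartesianProductWith h (weight _ 1) (λ (_ , d) → dominoWeight x n k d) h≈
             (tilings j) (dominoFirst (1 ℕ.+ (n ∸ k))) ⟩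
      tilingSum (λ i → x ^ F (leftFloor i)) 1 j *
      sum (map (λ (_ , d) → dominoWeight x n k d) (dominoFirst (1 ℕ.+ (n ∸ k))))
        ≈⟨ *-cong (leftSum x j) (dominoSum x n k (n ∸ k) (ℕ.m+[n∸m]≡n k≤n)) ⟩
      geometric x (F k) *
      (x ^ (F (1 ℕ.+ (n ∸ k)) ℕ.* F (1 ℕ.+ k)) * geometric (x ^ F k) (F (n ∸ k)))
        ≈⟨ x∙yz≈y∙xz _ _ _ ⟩
      x ^ (F (1 ℕ.+ (n ∸ k)) ℕ.* F (1 ℕ.+ k)) *
      (geometric x (F k) * geometric (x ^ F k) (F (n ∸ k)))
        -- Opposite to the I barriers, the left compartment has base `x` and the right one base
        -- `x ^ F k`.
        ≈⟨ *-cong (reflexive (≡.cong (x ^_) (ℕ.*-comm (F (1 ℕ.+ (n ∸ k))) (F (1 ℕ.+ k)))))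
                  (trans (*-comm _ _) (sym (geometric-* x (F (n ∸ k)) (F k)))) ⟩
      x ^ (F (1 ℕ.+ k) ℕ.* F (1 ℕ.+ (n ∸ k))) * geometric x (F (n ∸ k) ℕ.* F k)
        ≈⟨ *-congˡ (reflexive (≡.cong (geometric x) (ℕ.*-comm (F (n ∸ k)) (F k)))) ⟩
      x ^ (F (1 ℕ.+ k) ℕ.* F (1 ℕ.+ (n ∸ k))) * geometric x (F k ℕ.* F (n ∸ k)) ∎

    sum-barrierTilings :
      ∀ k → k ≤ n → (h : ∀ {k} → BarrierTiling n k → Carrier) →
      (∀ {k} l r → h {k} (I l r) ≈
        weight (λ i → x ^ (F (leftFloor i) ℕ.* F (1 ℕ.+ (n ∸ k)))) 1 l *
        weight (λ i → x ^ F (rightFloor n i)) (1 ℕ.+ k) r) →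
      (∀ {j} l (d : DominoFirst (1 ℕ.+ (n ∸ suc j))) → h (mkL l d) ≈
        weight (λ i → x ^ F (leftFloor i)) 1 l * dominoWeight x n (suc j) (proj₂ d)) →
      geometric x (F (suc n)) ≈ sum (map h (tilingsI n k ++ tilingsL n k))
    sum-barrierTilings k k≤n h hI≈ hL≈ = begin
      geometric x (F (suc n))
        ≡⟨ ≡.cong (geometric x ∘ F ∘ suc) (ℕ.m+[n∸m]≡n k≤n) ⟨
      geometric x (F (suc (k ℕ.+ (n ∸ k))))
        ≡⟨ ≡.cong (geometric x) (F-+ k (n ∸ k)) ⟩
      geometric x (F (1 ℕ.+ k) ℕ.* F (1 ℕ.+ (n ∸ k)) ℕ.+ F k ℕ.* F (n ∸ k))
        -- The I barriers account for the lowest exponents, the L barriers for the remaining ones.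
        ≈⟨ geometric-+ x (F (1 ℕ.+ k) ℕ.* F (1 ℕ.+ (n ∸ k))) (F k ℕ.* F (n ∸ k)) ⟩
      geometric x (F (1 ℕ.+ k) ℕ.* F (1 ℕ.+ (n ∸ k))) +
      x ^ (F (1 ℕ.+ k) ℕ.* F (1 ℕ.+ (n ∸ k))) * geometric x (F k ℕ.* F (n ∸ k))
        ≈⟨ +-cong (sum-tilingsI k k≤n h hI≈) (sum-tilingsL k k≤n h hL≈) ⟨
      sum (map h (tilingsI n k)) + sum (map h (tilingsL n k))
        ≈⟨ sum-map-++ h (tilingsI n k) (tilingsL n k) ⟨
      sum (map h (tilingsI n k ++ tilingsL n k)) ∎

open import Defs
open ≡ using (refl; sym; trans; cong; cong₂; module ≡-Reasoning)

-- The semiring ℤ[q]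

coeff-+ : ∀ p r i → coeff (p +ᴾ r) i ≡ coeff p i ℤ.+ coeff r i
coeff-+ []      r       i       = sym (ℤ.+-identityˡ (coeff r i))
coeff-+ (a ∷ p) []      i       = sym (ℤ.+-identityʳ (coeff (a ∷ p) i))
coeff-+ (a ∷ p) (b ∷ r) zero    = refl
coeff-+ (a ∷ p) (b ∷ r) (suc i) = coeff-+ p r i

coeff-map-* : ∀ a p i → coeff (map (a ℤ.*_) p) i ≡ a ℤ.* coeff p i
coeff-map-* a []      i       = sym (ℤ.*-zeroʳ a)
coeff-map-* a (b ∷ p) zero    = refl
coeff-map-* a (b ∷ p) (suc i) = coeff-map-* a p i

infixl 7 _⋆_

-- The Cauchy product of coefficient sequences.
_⋆_ : (ℕ → ℤ) → (ℕ → ℤ) → ℕ → ℤ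
(f ⋆ g) zero    = f 0 ℤ.* g 0
(f ⋆ g) (suc i) = f 0 ℤ.* g (suc i) ℤ.+ ((f ∘ suc) ⋆ g) i

⋆-cong : ∀ {f f′ g g′} → f ≗ f′ → g ≗ g′ → f ⋆ g ≗ f′ ⋆ g′
⋆-cong f≗ g≗ zero    = cong₂ ℤ._*_ (f≗ 0) (g≗ 0)
⋆-cong f≗ g≗ (suc i) =
  cong₂ ℤ._+_ (cong₂ ℤ._*_ (f≗ 0) (g≗ (suc i))) (⋆-cong (f≗ ∘ suc) g≗ i)

⋆-zeroˡ : ∀ g i → ((λ _ → 0ℤ) ⋆ g) i ≡ 0ℤ
⋆-zeroˡ g zero    = refl
⋆-zeroˡ g (suc i) = trans (ℤ.+-identityˡ _) (⋆-zeroˡ g i)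

⋆-distribʳ-+ : ∀ h f g i → ((λ j → f j ℤ.+ g j) ⋆ h) i ≡ (f ⋆ h) i ℤ.+ (g ⋆ h) i
⋆-distribʳ-+ h f g zero    = ℤ.*-distribʳ-+ (h 0) (f 0) (g 0)
⋆-distribʳ-+ h f g (suc i) = trans
  (cong (ℤ._+_ ((f 0 ℤ.+ g 0) ℤ.* h (suc i))) (⋆-distribʳ-+ h (f ∘ suc) (g ∘ suc) i))
  (algebra (f 0) (g 0) (h (suc i)) (((f ∘ suc) ⋆ h) i) (((g ∘ suc) ⋆ h) i))
  where
  algebra : ∀ a b c x y →
            (a ℤ.+ b) ℤ.* c ℤ.+ (x ℤ.+ y) ≡ a ℤ.* c ℤ.+ x ℤ.+ (b ℤ.* c ℤ.+ y)
  algebra = ℤ-Solver.solve-∀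

⋆-scaleˡ : ∀ a f g i → ((λ j → a ℤ.* f j) ⋆ g) i ≡ a ℤ.* (f ⋆ g) i
⋆-scaleˡ a f g zero    = ℤ.*-assoc a (f 0) (g 0)
⋆-scaleˡ a f g (suc i) = trans
  (cong (ℤ._+_ (a ℤ.* f 0 ℤ.* g (suc i))) (⋆-scaleˡ a (f ∘ suc) g i))
  (algebra a (f 0) (g (suc i)) (((f ∘ suc) ⋆ g) i))
  where
  algebra : ∀ a b c x → a ℤ.* b ℤ.* c ℤ.+ a ℤ.* x ≡ a ℤ.* (b ℤ.* c ℤ.+ x)
  algebra = ℤ-Solver.solve-∀

⋆-assoc : ∀ f g h i → ((f ⋆ g) ⋆ h) i ≡ (f ⋆ (g ⋆ h)) i
⋆-assoc f g h zero    = ℤ.*-assoc (f 0) (g 0) (h 0)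
⋆-assoc f g h (suc i) = begin
  f 0 ℤ.* g 0 ℤ.* h (suc i) ℤ.+ (((f ⋆ g) ∘ suc) ⋆ h) i
    -- By definition `(f ⋆ g) ∘ suc` is a multiple of `g ∘ suc` plus `(f ∘ suc) ⋆ g`.
    ≡⟨ cong (ℤ._+_ (f 0 ℤ.* g 0 ℤ.* h (suc i)))
         (⋆-distribʳ-+ h (λ j → f 0 ℤ.* g (suc j)) ((f ∘ suc) ⋆ g) i) ⟩
  f 0 ℤ.* g 0 ℤ.* h (suc i) ℤ.+
    (((λ j → f 0 ℤ.* g (suc j)) ⋆ h) i ℤ.+ (((f ∘ suc) ⋆ g) ⋆ h) i)
    ≡⟨ cong (ℤ._+_ (f 0 ℤ.* g 0 ℤ.* h (suc i)))
         (cong₂ ℤ._+_ (⋆-scaleˡ (f 0) (g ∘ suc) h i) (⋆-assoc (f ∘ suc) g h i)) ⟩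
  f 0 ℤ.* g 0 ℤ.* h (suc i) ℤ.+
    (f 0 ℤ.* ((g ∘ suc) ⋆ h) i ℤ.+ ((f ∘ suc) ⋆ (g ⋆ h)) i)
    ≡⟨ algebra (f 0) (g 0) (h (suc i)) (((g ∘ suc) ⋆ h) i) (((f ∘ suc) ⋆ (g ⋆ h)) i) ⟩
  f 0 ℤ.* (g ⋆ h) (suc i) ℤ.+ ((f ∘ suc) ⋆ (g ⋆ h)) i ∎
  where
  open ≡-Reasoning
  algebra : ∀ a b c x y →
            a ℤ.* b ℤ.* c ℤ.+ (a ℤ.* x ℤ.+ y) ≡ a ℤ.* (b ℤ.* c ℤ.+ x) ℤ.+ y
  algebra = ℤ-Solver.solve-∀

-- `_⋆_` recurses on its left factor; commutativity needs the right factor peeled instead.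
⋆-sucʳ : ∀ f g i → (f ⋆ g) (suc i) ≡ (f ⋆ (g ∘ suc)) i ℤ.+ f (suc i) ℤ.* g 0
⋆-sucʳ f g zero    = refl
⋆-sucʳ f g (suc i) = trans
  (cong (ℤ._+_ (f 0 ℤ.* g (suc (suc i)))) (⋆-sucʳ (f ∘ suc) g i))
  (sym (ℤ.+-assoc (f 0 ℤ.* g (suc (suc i))) _ _))

⋆-comm : ∀ f g i → (f ⋆ g) i ≡ (g ⋆ f) i
⋆-comm f g zero    = ℤ.*-comm (f 0) (g 0)
⋆-comm f g (suc i) = begin
  f 0 ℤ.* g (suc i) ℤ.+ ((f ∘ suc) ⋆ g) i
    ≡⟨ cong₂ ℤ._+_ (ℤ.*-comm (f 0) (g (suc i))) (⋆-comm (f ∘ suc) g i) ⟩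
  g (suc i) ℤ.* f 0 ℤ.+ (g ⋆ (f ∘ suc)) i
    ≡⟨ ℤ.+-comm (g (suc i) ℤ.* f 0) _ ⟩
  (g ⋆ (f ∘ suc)) i ℤ.+ g (suc i) ℤ.* f 0
    ≡⟨ ⋆-sucʳ g f i ⟨
  (g ⋆ f) (suc i) ∎
  where open ≡-Reasoning

-- Reduces the laws of `_*ᴾ_` up to `_≈_` to laws of sequences, which have no trailing zeros to
-- account for.
coeff-* : ∀ p r i → coeff (p *ᴾ r) i ≡ (coeff p ⋆ coeff r) i
coeff-* []      r i = sym (⋆-zeroˡ (coeff r) i)
coeff-* (a ∷ p) r i = trans
  (coeff-+ (map (a ℤ.*_) r) (0ℤ ∷ (p *ᴾ r)) i)
  (trans (cong (ℤ._+ coeff (0ℤ ∷ (p *ᴾ r)) i) (coeff-map-* a r i)) (step i))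
  where
  step : ∀ i → a ℤ.* coeff r i ℤ.+ coeff (0ℤ ∷ (p *ᴾ r)) i ≡ (coeff (a ∷ p) ⋆ coeff r) i
  step zero    = ℤ.+-identityʳ _
  step (suc i) = cong (ℤ._+_ (a ℤ.* coeff r (suc i))) (coeff-* p r i)

⋆-identityˡ : ∀ g i → (coeff 1ᴾ ⋆ g) i ≡ g i
⋆-identityˡ g zero    = ℤ.*-identityˡ (g 0)
⋆-identityˡ g (suc i) = trans
  (cong₂ ℤ._+_ (ℤ.*-identityˡ (g (suc i))) (⋆-zeroˡ g i))
  (ℤ.+-identityʳ (g (suc i)))

*ᴾ-cong : ∀ {p p′ r r′} → p ≈ p′ → r ≈ r′ → p *ᴾ r ≈ p′ *ᴾ r′
*ᴾ-cong {p} {p′} {r} {r′} p≈ r≈ i =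
  trans (coeff-* p r i) (trans (⋆-cong p≈ r≈ i) (sym (coeff-* p′ r′ i)))

*ᴾ-assoc : ∀ p r s → (p *ᴾ r) *ᴾ s ≈ p *ᴾ (r *ᴾ s)
*ᴾ-assoc p r s i = begin
  coeff ((p *ᴾ r) *ᴾ s) i          ≡⟨ coeff-* (p *ᴾ r) s i ⟩
  (coeff (p *ᴾ r) ⋆ coeff s) i     ≡⟨ ⋆-cong (coeff-* p r) (λ _ → refl) i ⟩
  (coeff p ⋆ coeff r ⋆ coeff s) i  ≡⟨ ⋆-assoc (coeff p) (coeff r) (coeff s) i ⟩
  (coeff p ⋆ (coeff r ⋆ coeff s)) i ≡⟨ ⋆-cong {f = coeff p} (λ _ → refl) (coeff-* r s) i ⟨
  (coeff p ⋆ coeff (r *ᴾ s)) i     ≡⟨ coeff-* p (r *ᴾ s) i ⟨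
  coeff (p *ᴾ (r *ᴾ s)) i          ∎
  where open ≡-Reasoning

*ᴾ-comm : ∀ p r → p *ᴾ r ≈ r *ᴾ p
*ᴾ-comm p r i =
  trans (coeff-* p r i) (trans (⋆-comm (coeff p) (coeff r) i) (sym (coeff-* r p i)))

*ᴾ-identityˡ : ∀ p → 1ᴾ *ᴾ p ≈ p
*ᴾ-identityˡ p i = trans (coeff-* 1ᴾ p i) (⋆-identityˡ (coeff p) i)

*ᴾ-distribʳ-+ᴾ : ∀ s p r → (p +ᴾ r) *ᴾ s ≈ (p *ᴾ s) +ᴾ (r *ᴾ s)
*ᴾ-distribʳ-+ᴾ s p r i = begin
  coeff ((p +ᴾ r) *ᴾ s) i
    ≡⟨ coeff-* (p +ᴾ r) s i ⟩
  (coeff (p +ᴾ r) ⋆ coeff s) i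
    ≡⟨ ⋆-cong (coeff-+ p r) (λ _ → refl) i ⟩
  ((λ j → coeff p j ℤ.+ coeff r j) ⋆ coeff s) i
    ≡⟨ ⋆-distribʳ-+ (coeff s) (coeff p) (coeff r) i ⟩
  (coeff p ⋆ coeff s) i ℤ.+ (coeff r ⋆ coeff s) i
    ≡⟨ cong₂ ℤ._+_ (coeff-* p s i) (coeff-* r s i) ⟨
  coeff (p *ᴾ s) i ℤ.+ coeff (r *ᴾ s) i
    ≡⟨ coeff-+ (p *ᴾ s) (r *ᴾ s) i ⟨
  coeff ((p *ᴾ s) +ᴾ (r *ᴾ s)) i ∎
  where open ≡-Reasoning

+ᴾ-cong : ∀ {p p′ r r′} → p ≈ p′ → r ≈ r′ → p +ᴾ r ≈ p′ +ᴾ r′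
+ᴾ-cong {p} {p′} {r} {r′} p≈ r≈ i =
  trans (coeff-+ p r i) (trans (cong₂ ℤ._+_ (p≈ i) (r≈ i)) (sym (coeff-+ p′ r′ i)))

+ᴾ-assoc : ∀ p r s → (p +ᴾ r) +ᴾ s ≈ p +ᴾ (r +ᴾ s)
+ᴾ-assoc p r s i = begin
  coeff ((p +ᴾ r) +ᴾ s) i                    ≡⟨ coeff-+ (p +ᴾ r) s i ⟩
  coeff (p +ᴾ r) i ℤ.+ coeff s i             ≡⟨ cong (ℤ._+ coeff s i) (coeff-+ p r i) ⟩
  coeff p i ℤ.+ coeff r i ℤ.+ coeff s i      ≡⟨ ℤ.+-assoc (coeff p i) _ _ ⟩
  coeff p i ℤ.+ (coeff r i ℤ.+ coeff s i)    ≡⟨ cong (ℤ._+_ (coeff p i)) (coeff-+ r s i) ⟨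
  coeff p i ℤ.+ coeff (r +ᴾ s) i             ≡⟨ coeff-+ p (r +ᴾ s) i ⟨
  coeff (p +ᴾ (r +ᴾ s)) i                    ∎
  where open ≡-Reasoning

+ᴾ-comm : ∀ p r → p +ᴾ r ≈ r +ᴾ p
+ᴾ-comm p r i =
  trans (coeff-+ p r i) (trans (ℤ.+-comm (coeff p i) (coeff r i)) (sym (coeff-+ r p i)))

ℤ[q]-commutativeSemiring : CommutativeSemiring 0ℓ 0ℓ
ℤ[q]-commutativeSemiring = record
  { Carrier = Poly
  ; _≈_     = _≈_
  ; _+_     = _+ᴾ_
  ; _*_     = _*ᴾ_
  ; 0#      = 0ᴾ
  ; 1#      = 1ᴾ
  ; isCommutativeSemiring = isCommutativeSemiringˡ record
    { +-isCommutativeMonoid = isCommutativeMonoidˡ record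
      { isSemigroup = record
        { isMagma = record
          { isEquivalence = isEquivalenceᴾ
          ; ∙-cong        = λ {p} {p′} {r} {r′} → +ᴾ-cong {p} {p′} {r} {r′}
          }
        ; assoc = +ᴾ-assoc
        }
      ; identityˡ = λ p i → refl
      ; comm      = +ᴾ-comm
      }
    ; *-isCommutativeMonoid = isCommutativeMonoidˡ record
      { isSemigroup = record
        { isMagma = record
          { isEquivalence = isEquivalenceᴾ
          ; ∙-cong        = λ {p} {p′} {r} {r′} → *ᴾ-cong {p} {p′} {r} {r′}
          }
        ; assoc = *ᴾ-assoc
        }
      ; identityˡ = *ᴾ-identityˡ
      ; comm      = *ᴾ-comm
      }
    ; distribʳ = *ᴾ-distribʳ-+ᴾ
    ; zeroˡ    = λ p i → refl
    }
  }
  where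
  isEquivalenceᴾ : IsEquivalence _≈_
  isEquivalenceᴾ = record
    { refl  = λ i → refl
    ; sym   = λ p≈r i → sym (p≈r i)
    ; trans = λ p≈r r≈s i → trans (p≈r i) (r≈s i)
    }

-- The weight of the right compartment of an L barrier

-- The function rightWeight local to B is not in scope, and B applies it only
-- to tilings of 1 + (n ∸ k) cells, an index at which no StartsWithDomino can be
-- matched on. Here it gets a name, with the index of its last argument
-- independent of n and k; the name is found by unification.
--
-- At n = 0 the index reduces to 1 for every positive k. There cong! can abstract
-- it, provided that the tiling on which B is evaluated is an expression that
-- type checks at every index: cong! elaborates its copies anew, each at its own
-- type. Such an expression is a field of a copattern lambda applied to an
-- element of Slot, since neither records the index in the term. It is stuck at
-- a variable index, but reduces to the tiling monomino empty at index 1, so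
-- that the endpoints computed by cong! are the expected ones.
data Slot (A : Set) (i : ℕ) : Set where
  filled : A → Slot A i
  vacant : Maybe (i ≡ 1) → Slot A i

-- An empty type: only under this assumption is there a tiling starting with a
-- domino at every index.
Absurd : Set
Absurd = StartsWithDomino (monomino empty)

record GenericTiling (m i : ℕ) : Set where
  no-eta-equality
  field tiling : Slot (Tiling m) i → (Absurd → Tiling m) → Tiling m
open GenericTiling

record GenericDomino {m : ℕ} (t : Tiling m) (i : ℕ) : Set where
  no-eta-equality
  field starts : Slot (StartsWithDomino t) i → (Absurd → StartsWithDomino t) → StartsWithDomino t
open GenericDomino

isOne : ∀ i → Maybe (i ≡ 1)
isOne zero          = nothing
isOne (suc zero)    = just refl
isOne (suc (suc _)) = nothing

ignoring : {A : Set} → A → Bool → A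
ignoring a _ = a

-- Unifying the type of `isCong` with the proof built by `cong!` reads off the context `C` that the
-- tactic found.
data IsCong {a b : ℕ} (eq : a ≡ b) (C : ℕ → Poly) : {x y : Poly} → x ≡ y → Set where
  isCong : IsCong eq C (cong C eq)

-- The endpoints x and y are the same application of rightWeight, x as B
-- produces it and y in normal form, because Agda normalises a solution in order
-- to remove the variable u from it. The arguments N, T, O and D are
-- metavariables when this happens, and hence are not unfolded in y. So x and y
-- differ in the occurrences of the index, and in the argument of N.
abstractIndex :
  ∀ {k} .{p : 1 ≤ k} {l : Tiling (k ∸ 1)}
  (N′ : ℕ → ℕ) (let m′ = 1 ℕ.+ (N′ (1 ℕ.+ 0) ∸ k)) (a′ : Absurd → Tiling m′)
  (T′ : GenericTiling m′ m′) (O′ : ∀ i → Maybe (i ≡ 1))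
  (D′ : GenericDomino (tiling T′ (vacant (O′ m′)) a′) m′)
  (N : ℕ → ℕ) (let m = 1 ℕ.+ (N (1 ℕ.+ 0) ∸ k)) (a : Absurd → Tiling m)
  (T : GenericTiling m m) (O : ∀ i → Maybe (i ≡ 1))
  (D : GenericDomino (tiling T (vacant (O m)) a) m)
  (b : Absurd → StartsWithDomino (tiling T (vacant (O m)) a)) →
  {x : Poly} →
  weightFrom (λ i → q ^ F (leftFloor i)) 1 l *ᴾ x ≡
    B {N (1 ℕ.+ 0)} {k} (L p l (tiling T (vacant (O m)) a) (starts D (vacant (O m)) b)) →
  {y : Poly} →
  ((u : Bool) → weightFrom (λ i → q ^ F (leftFloor i)) 1 l *ᴾ y ≡
    B {ignoring (N (1 ℕ.+ 0)) u} {k}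
      (L p l (tiling T (vacant (O m)) a) (starts D (vacant (O m)) b))) →
  _≡_ {A = Σ (ℕ → ℕ) λ N → let m = 1 ℕ.+ (N (1 ℕ.+ 0) ∸ k) in
           Σ (Absurd → Tiling m) λ a → Σ (GenericTiling m m) λ T →
           Σ (∀ i → Maybe (i ≡ 1)) λ O →
           GenericDomino (tiling T (vacant (O m)) a) m}
      (N , a , T , O , D) (N′ , a′ , T′ , O′ , D′) →
  {i j : ℕ} (eq : i ≡ j) (x≡y : x ≡ y) {C : ℕ → Poly} → IsCong eq C x≡y → ℕ → Poly
abstractIndex _ _ _ _ _ _ _ _ _ _ _ _ _ _ _ _ {C} _ = C

-- With N = pred, the argument n of rightWeight becomes pred of the abstracted
-- index; it is 0 where the index is 1.
weightAtIndex : ∀ k .(p : 1 ≤ suc k) (l : Tiling k) → Absurd → 1 ≡ 1 → ℕ → Poly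
weightAtIndex k p l absurd eq = abstractIndex {suc k} {p} {l} pred
  (λ ())
  (λ { .tiling (filled t)           _ → t
     ; .tiling (vacant (just refl)) _ → monomino empty
     ; .tiling (vacant nothing)     a → a absurd })
  isOne
  (λ { .starts (filled s)           _ → s
     ; .starts (vacant (just refl)) _ → absurd
     ; .starts (vacant nothing)     b → b absurd })
  _ _ _ _ _ (λ ()) refl (λ u → refl) refl eq (cong! eq) isCong

mutual
  rightWeight : ∀ n k .(p : 1 ≤ suc k) (l : Tiling k) (r : Tiling (1 ℕ.+ (n ∸ suc k)))
                (s : StartsWithDomino r) {m} {t : Tiling m} → StartsWithDomino t → Poly
  rightWeight = _

  -- Abstracting a constructor by "with" affects only its occurrences of the
  -- given type. This separates the tiling on which B was evaluated from the
  -- argument of rightWeight; the last line then determines rightWeight.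
  solveRightWeight :
    ∀ k .(p : 1 ≤ suc k) (l : Tiling k) (absurd : Absurd) (eq : 1 ≡ 1) (m : ℕ) (P : Poly → Set)
    (h : ∀ {m t} n r s (d : StartsWithDomino {m} t) → P (rightWeight n k p l r s d)) →
    Maybe (P (weightAtIndex k p l absurd eq m))
  solveRightWeight k p l absurd eq m P h
    with Slot.vacant {StartsWithDomino {m} _} {m} (isOne m)
       | Slot.vacant {StartsWithDomino {1 ℕ.+ (pred m ∸ suc k)} _} {m} (isOne m)
  ... | vacant _ | _        = nothing
  ... | filled _ | vacant _ = nothing
  ... | filled d | filled s
    with Slot.vacant {Tiling m} {m} (isOne m)
       | Slot.vacant {Tiling (1 ℕ.+ (pred m ∸ suc k))} {m} (isOne m)
  ... | vacant _ | _        = nothing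
  ... | filled _ | vacant _ = nothing
  ... | filled t | filled r with pred m
  -- As `P` is a variable, its arguments must agree: `rightWeight` applied to distinct variables is
  -- unified with the abstracted weight.
  ... | n = just (h n r s d)

-- Transfer to polynomials in `q`

open BarrierSums ℤ[q]-commutativeSemiring using (weight; dominoWeight; sum-barrierTilings)

weightFrom≡weight : ∀ w i {m} (t : Tiling m) → weightFrom w i t ≡ weight w i t
weightFrom≡weight w i empty        = refl
weightFrom≡weight w i (monomino t) = cong (1ᴾ *ᴾ_) (weightFrom≡weight w (1 ℕ.+ i) t)
weightFrom≡weight w i (domino t)   = cong (w i *ᴾ_) (weightFrom≡weight w (2 ℕ.+ i) t)

-- With the index `m` independent of `n` and `k`, `d` can be matched, after which `rightWeight`
-- unfolds.
rightWeight≡dominoWeight :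
  ∀ n k .(p : 1 ≤ suc k) l r s {m} {t : Tiling m} (d : StartsWithDomino t) →
  rightWeight n k p l r s d ≡ dominoWeight q n (suc k) d
rightWeight≡dominoWeight n k p l r s (domino t) =
  cong (q ^ (F (rightFloor n (suc k)) ℕ.* F (suc k ℕ.+ 1)) *ᴾ_) (weightFrom≡weight _ (3 ℕ.+ k) t)

B-I : ∀ {n k} (l : Tiling k) (r : Tiling (n ∸ k)) → B (I {n} l r) ≡
      weight (λ i → q ^ (F (leftFloor i) ℕ.* F (1 ℕ.+ (n ∸ k)))) 1 l *ᴾ
      weight (λ i → q ^ F (rightFloor n i)) (1 ℕ.+ k) r
B-I {k = k} l r = cong₂ _*ᴾ_ (weightFrom≡weight _ 1 l) (weightFrom≡weight _ (1 ℕ.+ k) r)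

B-mkL : ∀ {n j} (l : Tiling j) (d : DominoFirst (1 ℕ.+ (n ∸ suc j))) → B (mkL {n} l d) ≡
        weight (λ i → q ^ F (leftFloor i)) 1 l *ᴾ dominoWeight q n (suc j) (proj₂ d)
B-mkL {n} {j} l (r , s) =
  -- Here `rightWeight` is checked against the function local to `B`. The proof `s` serves both as a
  -- parameter of that function and as its argument.
  cong₂ _*ᴾ_ (weightFrom≡weight _ 1 l) (rightWeight≡dominoWeight n j (s≤s z≤n) l r s s)

theorem2p3 : (n k : ℕ) → 1 ≤ n → k ≤ n →
    [ F (suc n) ]q ≈ ∑ (barrierTilings n k) B
-- `[_]q` and `∑` unfold to the sums of the generic identity.
theorem2p3 n k _ k≤n = sum-barrierTilings q k k≤n B
  (λ l r i → cong (λ p → coeff p i) (B-I {n} l r))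
  (λ l d i → cong (λ p → coeff p i) (B-mkL {n} l d))
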